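{- Every finite simple graph $G$ with at least one vertex contains a nonempty $2$-cheap set.
   Context: For a vertex $v$, $\zeta(v)=\max_H\delta(H)$, the maximum over all subgraphs $H$ of $G$ containing $v$, where $\delta(H)$ is the minimum degree. $N[X]=X\cup\bigcup_{v\in X}N(v)$. For an integer $k\geq 0$, a $k$-cheap set of $G$ is either a subset of the isolated vertices of $G$, or a set $S$ of non-isolated vertices of $G$ such that (i) $\sum_{v\in N[S]}\frac{1}{\zeta(v)+\frac{1}{k+1}}\leq |S|$ and (ii) $\Delta(G[S])\leq k$. -}

module Defs where

open import Data.Nat using (ℕ; zero; suc; _+_; _*_; _≤_)
open import Data.Bool using (Bool; true; false; _∧_; _∨_; if_then_else_)
open import Data.Fin using (Fin)
open import Data.Fin.Subset using (Subset; _∈_; _∉_; _⊆_; _∩_; ∣_∣; Nonempty; Empty)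
open import Data.Vec using (lookup; tabulate)
open import Data.List using (List; allFin; foldr)
open import Data.Bool.ListAction using (any)
open import Data.Integer using (+_)
open import Data.Rational using (ℚ; _/_; 0ℚ) renaming (_+_ to _+ℚ_; _≤_ to _≤ℚ_)
open import Data.Product using (Σ; ∃; _×_)
open import Data.Sum using (_⊎_)
open import Relation.Binary.PropositionalEquality using (_≡_)

record Graph (n : ℕ) : Set where
  field
    adj   : Fin n → Subset n
    sym   : ∀ {u w} → w ∈ adj u → u ∈ adj w
    irrefl : ∀ {u} → u ∉ adj u
open Graph public

record Subgraph {n : ℕ} (G : Graph n) : Set where
  field
    V     : Subset n
    E     : Fin n → Subset n
    E⊆    : ∀ u → E u ⊆ adj G u
    Esym  : ∀ {u w} → w ∈ E u → u ∈ E w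
    Eends : ∀ {u w} → w ∈ E u → u ∈ V × w ∈ V
open Subgraph public

degH : ∀ {n} {G : Graph n} → Subgraph G → Fin n → ℕ
degH H u = ∣ E H u ∣

MinDeg : ∀ {n} {G : Graph n} → Subgraph G → ℕ → Set
MinDeg H d = (∃ λ u → u ∈ V H × degH H u ≡ d) × (∀ u → u ∈ V H → d ≤ degH H u)

IsZeta : ∀ {n} → Graph n → Fin n → ℕ → Set
IsZeta G v z =
  (Σ (Subgraph G) λ H → v ∈ V H × MinDeg H z)
  × (∀ (H : Subgraph G) d → v ∈ V H → MinDeg H d → d ≤ z)

Isolated : ∀ {n} → Graph n → Fin n → Set
Isolated G v = Empty (adj G v)

closedNbhd : ∀ {n} → Graph n → Subset n → Subset n
closedNbhd {n} G S =
  tabulate λ w → lookup S w ∨ any (λ v → lookup S v ∧ lookup (adj G v) w) (allFin n)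

sumOver : ∀ {n} → Subset n → (Fin n → ℚ) → ℚ
sumOver {n} T f = foldr (λ w acc → (if lookup T w then f w else 0ℚ) +ℚ acc) 0ℚ (allFin n)

-- 1 / (z + 1/(k+1)), written as the equal fraction (k+1) / ((k+1) z + 1)
weight : ℕ → ℕ → ℚ
weight k z = + (suc k) / (1 + suc k * z)

IsCheap : ∀ {n} → (G : Graph n) → (ζ : Fin n → ℕ) → ℕ → Subset n → Set
IsCheap G ζ k S =
  (∀ v → v ∈ S → Isolated G v)
  ⊎ ( (∀ v → v ∈ S → Nonempty (adj G v))
    × (sumOver (closedNbhd G S) (λ v → weight k (ζ v)) ≤ℚ (+ ∣ S ∣ / 1))
    × (∀ v → v ∈ S → ∣ adj G v ∩ S ∣ ≤ k) )

{-# OPTIONS --safe #-}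
module Submission where

-- Suppose that G has no cheap set; in particular it has no isolated vertex. We peel off the levels
-- {ζ = D}, D = 1, 2, …, maintaining that the set A of vertices below level D is independent and that
-- deg a ≤ ζ a ≤ 2 for a ∈ A. If weights are multiplied by D + 1/3, a vertex of level at least D costs at
-- most 1 while a vertex of S brings D + 1/3; so three vertices of S pay for D vertices each and one more.
-- Vertices of A adjacent to N[S] more than pay for themselves, and each vertex outside A has at most one
-- neighbour in A. Let L₁ be the set of vertices of degree at most D in G − A, let L₂ be the same for
-- G − A − L₁, and L₃ for G − A − L₁ − L₂. Suitable sets S of at most four vertices show that L₁ is
-- independent, that each vertex of L₂ has exactly one neighbour in L₁, that L₂ is independent, and that
-- L₃ = ∅. Hence {ζ = D} ⊆ L₁ ∪ L₂, and the lower cost of levels above D makes an L₂-vertex with its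
-- L₁-neighbour cheap, so L₂ = ∅, and then a single vertex of level D cheap unless D ≤ 2 and it has no
-- neighbour in A; so level D may join A. In the end A contains all vertices, yet is independent.

open import Defs hiding (sym)
open import Data.Nat using (ℕ; zero; suc; _+_; _*_; _≤_; _<_; _≤?_; _<?_; z≤n; s≤s)
open import Data.Nat.Properties hiding (_≟_)
open import Data.Nat.Tactic.RingSolver using (solve-∀)
open import Data.Nat.ListAction using (sum)
open import Data.Nat.ListAction.Properties using (sum-++; sum-↭)
open import Data.Bool using (Bool; true; false; if_then_else_)
open import Data.Bool.Properties using (T-≡; T-∨; T-∧)
open import Data.Fin using (Fin; _≟_) renaming (zero to fzero; suc to fsuc)
open import Data.Fin.Properties using (any?; all?)
open import Data.Fin.Subset using (Subset; Nonempty; ⊥; ⁅_⁆; _∪_; _∩_; ∣_∣)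
  renaming (_∈_ to _∈ₛ_)
open import Data.Fin.Subset.Properties renaming (_∈?_ to _∈ₛ?_)
open import Data.Integer as ℤ using (+_)
import Data.Integer.Properties as ℤ
open import Data.Rational using (ℚ; 0ℚ; toℚᵘ) renaming (_/_ to _/ℚ_; _≤_ to _≤ℚ_; _+_ to _+ℚ_)
import Data.Rational.Properties as ℚ
open import Data.Rational.Unnormalised as ℚᵘ using (ℚᵘ; mkℚᵘ; *≡*; *≤*)
import Data.Rational.Unnormalised.Properties as ℚᵘ
open import Data.List using (List; []; _∷_; _++_; [_]; length; map; filter; foldr; concat; concatMap; allFin)
open import Data.List.Extrema.Nat using (argmin; argmin-all; f[argmin]≤f[xs])
open import Data.List.Properties using (length-++; map-++; length-filter; filter-notAll)
open import Data.List.Membership.Propositional using (_∈_; lose; find)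
open import Data.List.Membership.Propositional.Properties
  using (∈-allFin; ∈-filter⁺; ∈-filter⁻; ∈-++⁺ˡ; ∈-++⁺ʳ; ∈-++⁻; ∈-∃++; ∈-concatMap⁺)
open import Data.List.Relation.Unary.Any as Any using (Any; here; there)
open import Data.List.Relation.Unary.Any.Properties using (any⁻; concat⁺)
open import Data.List.Relation.Unary.All as All using (All; []; _∷_)
open import Data.List.Relation.Unary.AllPairs using ([]; _∷_)
open import Data.List.Relation.Unary.Unique.Propositional using (Unique)
open import Data.List.Relation.Unary.Unique.Propositional.Properties using (allFin⁺; filter⁺; ++⁺)
open import Data.List.Relation.Binary.Permutation.Propositional.Properties using (shift; map⁺)
open import Data.Vec using (_∷_; lookup; tabulate)
open import Data.Vec.Properties using (lookup∘tabulate; []=⇒lookup; lookup⇒[]=)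
open import Data.Product using (Σ; ∃; ∃₂; _×_; _,_; proj₁; proj₂)
open import Data.Sum as Sum using (_⊎_; inj₁; inj₂)
open import Data.Empty using (⊥-elim) renaming (⊥ to False)
open import Function using (_∘_; id; Equivalence)
open import Relation.Nullary using (¬_; Dec; yes; no; does; contradiction; ¬?; _×-dec_; _⊎-dec_; _→-dec_)
open import Relation.Nullary.Decidable using (dec-true; decidable-stable)
open import Relation.Unary using (Decidable)
open import Relation.Unary.Properties using (U?)
open import Relation.Binary.PropositionalEquality
  using (_≡_; _≢_; refl; sym; trans; cong; subst; subst₂)

-- Lists of vertices and subsets

∣⁅x⁆∪p∣≤1+∣p∣ : ∀ {n} x (p : Subset n) → ∣ ⁅ x ⁆ ∪ p ∣ ≤ suc ∣ p ∣
∣⁅x⁆∪p∣≤1+∣p∣ fzero (true ∷ p) = s≤s (≤-trans (≤-reflexive (cong ∣_∣ (∪-identityˡ p))) (n≤1+n _))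
∣⁅x⁆∪p∣≤1+∣p∣ fzero (false ∷ p) = s≤s (≤-reflexive (cong ∣_∣ (∪-identityˡ p)))
∣⁅x⁆∪p∣≤1+∣p∣ (fsuc x) (true ∷ p) = s≤s (∣⁅x⁆∪p∣≤1+∣p∣ x p)
∣⁅x⁆∪p∣≤1+∣p∣ (fsuc x) (false ∷ p) = ∣⁅x⁆∪p∣≤1+∣p∣ x p

module _ {n : ℕ} where

  fromList : List (Fin n) → Subset n
  fromList = foldr (λ x p → ⁅ x ⁆ ∪ p) ⊥

  ∈-fromList⁺ : ∀ {x l} → x ∈ l → x ∈ₛ fromList l
  ∈-fromList⁺ (here refl) = x∈p∪q⁺ (inj₁ (x∈⁅x⁆ _))
  ∈-fromList⁺ (there x∈l) = x∈p∪q⁺ (inj₂ (∈-fromList⁺ x∈l))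

  ∈-fromList⁻ : ∀ {x} l → x ∈ₛ fromList l → x ∈ l
  ∈-fromList⁻ [] x∈ = contradiction x∈ ∉⊥
  ∈-fromList⁻ (y ∷ l) x∈ with x∈p∪q⁻ ⁅ y ⁆ (fromList l) x∈
  ... | inj₁ x∈y = here (x∈⁅y⁆⇒x≡y y x∈y)
  ... | inj₂ x∈l = there (∈-fromList⁻ l x∈l)

  ∣fromList∣≤length : ∀ l → ∣ fromList l ∣ ≤ length l
  ∣fromList∣≤length [] = ≤-reflexive (∣⊥∣≡0 n)
  ∣fromList∣≤length (x ∷ l) = begin
    ∣ ⁅ x ⁆ ∪ fromList l ∣ ≤⟨ ∣⁅x⁆∪p∣≤1+∣p∣ x (fromList l) ⟩
    suc ∣ fromList l ∣     ≤⟨ s≤s (∣fromList∣≤length l) ⟩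
    suc (length l)         ∎
    where open ≤-Reasoning

  cover⇒∣p∣≤length : ∀ {p : Subset n} {l} → (∀ {x} → x ∈ₛ p → x ∈ l) → ∣ p ∣ ≤ length l
  cover⇒∣p∣≤length {l = l} p⊆l =
    ≤-trans (p⊆q⇒∣p∣≤∣q∣ (∈-fromList⁺ ∘ p⊆l)) (∣fromList∣≤length l)

  unique⇒length≤∣p∣ : ∀ {p : Subset n} {l} → Unique l → (∀ {x} → x ∈ l → x ∈ₛ p) → length l ≤ ∣ p ∣
  unique⇒length≤∣p∣ {l = []} _ _ = z≤n
  unique⇒length≤∣p∣ {p} {x ∷ l} (x∉l ∷ l!) l⊆p = ≤-trans
    (s≤s (unique⇒length≤∣p∣ l! λ y∈l →
      x∈p∧x≢y⇒x∈p-y (l⊆p (there y∈l)) (All.lookup x∉l y∈l ∘ sym)))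
    (x∈p⇒∣p-x∣<∣p∣ (l⊆p (here refl)))

  unique⊆⇒length≤ : ∀ {l m : List (Fin n)} → Unique l → (∀ {x} → x ∈ l → x ∈ m) → length l ≤ length m
  unique⊆⇒length≤ {m = m} l! l⊆m =
    ≤-trans (unique⇒length≤∣p∣ l! (∈-fromList⁺ ∘ l⊆m)) (∣fromList∣≤length m)

  subsetOf : ∀ {P : Fin n → Set} → Decidable P → Subset n
  subsetOf P? = tabulate (does ∘ P?)

  ∈-subsetOf⁺ : ∀ {P : Fin n → Set} (P? : Decidable P) {x} → P x → x ∈ₛ subsetOf P?
  ∈-subsetOf⁺ P? {x} px = lookup⇒[]= x _ (trans (lookup∘tabulate _ x) (dec-true (P? x) px))

  ∈-subsetOf⁻ : ∀ {P : Fin n → Set} (P? : Decidable P) {x} → x ∈ₛ subsetOf P? → P x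
  ∈-subsetOf⁻ P? {x} x∈ with P? x | trans (sym (lookup∘tabulate (does ∘ P?) x)) ([]=⇒lookup x∈)
  ... | yes px | _ = px

  ∈-closedNbhd⁻ : ∀ (G : Graph n) S {x} → x ∈ₛ closedNbhd G S → x ∈ₛ S ⊎ ∃ λ v → v ∈ₛ S × x ∈ₛ adj G v
  ∈-closedNbhd⁻ G S {x} x∈ with
    Equivalence.to T-∨ (Equivalence.from T-≡ (trans (sym (lookup∘tabulate _ x)) ([]=⇒lookup x∈)))
  ... | inj₁ t = inj₁ (lookup⇒[]= x S (Equivalence.to T-≡ t))
  ... | inj₂ t with find (any⁻ _ (allFin n) t)
  ...   | v , _ , t′ with Equivalence.to (T-∧ {lookup S v}) t′
  ...     | tS , tG = inj₂ (v , lookup⇒[]= v S (Equivalence.to T-≡ tS)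
                              , lookup⇒[]= x (adj G v) (Equivalence.to T-≡ tG))

-- Weights with a common denominator

weight≤ : ∀ k c z → suc k * 3 ≤ c * (1 + 3 * z) → toℚᵘ (weight 2 z) ℚᵘ.≤ mkℚᵘ (+ c) k
weight≤ k c z h = ℚᵘ.≤-trans (ℚᵘ.≤-reflexive (ℚ.toℚᵘ-fromℚᵘ (mkℚᵘ (+ 3) (3 * z))))
  (*≤* (subst₂ ℤ._≤_ (trans (cong +_ (*-comm (suc k) 3)) (ℤ.pos-* 3 (suc k)))
                     (ℤ.pos-* c (1 + 3 * z)) (ℤ.+≤+ h)))

+-sameDenom : ∀ a b k → mkℚᵘ (+ a) k ℚᵘ.+ mkℚᵘ (+ b) k ℚᵘ.≃ mkℚᵘ (+ (a + b)) k
+-sameDenom a b k = *≡* (begin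
  (+ a ℤ.* + suc k ℤ.+ + b ℤ.* + suc k) ℤ.* + suc k ≡⟨ cong (ℤ._* + suc k) (ℤ.*-distribʳ-+ (+ suc k) (+ a) (+ b)) ⟨
  (+ a ℤ.+ + b) ℤ.* + suc k ℤ.* + suc k             ≡⟨ ℤ.*-assoc (+ (a + b)) (+ suc k) (+ suc k) ⟩
  + (a + b) ℤ.* (+ suc k ℤ.* + suc k)               ≡⟨ cong (+ (a + b) ℤ.*_) (ℤ.pos-* (suc k) (suc k)) ⟨
  + (a + b) ℤ.* (+ (suc k * suc k))                 ∎)
  where open Relation.Binary.PropositionalEquality.≡-Reasoning

module _ {n : ℕ} (T : Subset n) (ζ : Fin n → ℕ) (k : ℕ) (c : Fin n → ℕ)
         (c-valid : ∀ x → suc k * 3 ≤ c x * (1 + 3 * ζ x)) where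

  private
    weightSum : List (Fin n) → ℚ
    weightSum = foldr (λ w acc → (if lookup T w then weight 2 (ζ w) else 0ℚ) +ℚ acc) 0ℚ

    costSum : List (Fin n) → ℕ
    costSum = foldr (λ w acc → (if lookup T w then c w else 0) + acc) 0

    weightSum≤ : ∀ l → toℚᵘ (weightSum l) ℚᵘ.≤ mkℚᵘ (+ costSum l) k
    weightSum≤ [] = *≤* (ℤ.+≤+ z≤n)
    weightSum≤ (x ∷ l) = begin
      toℚᵘ (w +ℚ weightSum l)                   ≃⟨ ℚ.toℚᵘ-homo-+ w (weightSum l) ⟩
      toℚᵘ w ℚᵘ.+ toℚᵘ (weightSum l)            ≤⟨ ℚᵘ.+-mono-≤ (w≤ (lookup T x)) (weightSum≤ l) ⟩
      mkℚᵘ (+ d (lookup T x)) k ℚᵘ.+ mkℚᵘ (+ costSum l) k ≃⟨ +-sameDenom (d (lookup T x)) (costSum l) k ⟩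
      mkℚᵘ (+ costSum (x ∷ l)) k                ∎
      where
      open ℚᵘ.≤-Reasoning
      w = if lookup T x then weight 2 (ζ x) else 0ℚ
      d : Bool → ℕ
      d b = if b then c x else 0
      w≤ : ∀ b → toℚᵘ (if b then weight 2 (ζ x) else 0ℚ) ℚᵘ.≤ mkℚᵘ (+ d b) k
      w≤ true = weight≤ k (c x) (ζ x) (c-valid x)
      w≤ false = *≤* (ℤ.+≤+ z≤n)

    costSum≤ : ∀ l m → Unique l → (∀ {x} → x ∈ l → x ∈ₛ T → x ∈ m) → costSum l ≤ sum (map c m)
    costSum≤ [] m _ _ = z≤n
    costSum≤ (x ∷ l) m (x∉l ∷ l!) l⊆m with lookup T x in eq
    ... | false = costSum≤ l m l! (l⊆m ∘ there)
    ... | true with ∈-∃++ (l⊆m (here refl) (lookup⇒[]= x T eq))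
    ...   | ys , zs , refl = begin
      c x + costSum l                          ≤⟨ +-monoʳ-≤ (c x) (costSum≤ l (ys ++ zs) l! l⊆) ⟩
      c x + sum (map c (ys ++ zs))             ≡⟨ sum-↭ (map⁺ c (shift x ys zs)) ⟨
      sum (map c (ys ++ x ∷ zs))               ∎
      where
      open ≤-Reasoning
      l⊆ : ∀ {y} → y ∈ l → y ∈ₛ T → y ∈ ys ++ zs
      l⊆ y∈l y∈T with ∈-++⁻ ys (l⊆m (there y∈l) y∈T)
      ... | inj₁ y∈ys = ∈-++⁺ˡ y∈ys
      ... | inj₂ (here refl) = contradiction refl (All.lookup x∉l y∈l)
      ... | inj₂ (there y∈zs) = ∈-++⁺ʳ ys y∈zs

  sumOver-weight≤ : ∀ m N → (∀ {x} → x ∈ₛ T → x ∈ m) → sum (map c m) ≤ suc k * N →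
                    sumOver T (λ v → weight 2 (ζ v)) ≤ℚ (+ N /ℚ 1)
  sumOver-weight≤ m N T⊆m cost≤ = ℚ.toℚᵘ-cancel-≤ (begin
    toℚᵘ (weightSum (allFin n))     ≤⟨ weightSum≤ (allFin n) ⟩
    mkℚᵘ (+ costSum (allFin n)) k   ≤⟨ *≤* (subst₂ ℤ._≤_ (ℤ.pos-* (costSum (allFin n)) 1) (ℤ.pos-* N (suc k)) (ℤ.+≤+ cost≤N)) ⟩
    mkℚᵘ (+ N) 0                    ≃⟨ ℚ.toℚᵘ-fromℚᵘ (mkℚᵘ (+ N) 0) ⟨
    toℚᵘ (+ N /ℚ 1)                 ∎)
    where
    open ℚᵘ.≤-Reasoning
    cost≤N : costSum (allFin n) * 1 ≤ N * suc k
    cost≤N = subst₂ _≤_ (sym (*-identityʳ _)) (*-comm (suc k) N)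
      (≤-trans (costSum≤ (allFin n) m (allFin⁺ n) (λ _ → T⊆m)) cost≤)

module _ {n : ℕ} (G : Graph n) where

  infix 4 _~_ _~?_

  _~_ : Fin n → Fin n → Set
  u ~ v = v ∈ₛ adj G u

  _~?_ : ∀ u v → Dec (u ~ v)
  u ~? v = v ∈ₛ? adj G u

  ~-sym : ∀ {u v} → u ~ v → v ~ u
  ~-sym = Graph.sym G

  ~-irrefl : ∀ {v} → ¬ v ~ v
  ~-irrefl = irrefl G

  nbrs : ∀ {P : Fin n → Set} → Decidable P → Fin n → List (Fin n)
  nbrs P? v = filter (λ y → (v ~? y) ×-dec P? y) (allFin n)

  module _ {P : Fin n → Set} (P? : Decidable P) where

    ∈-nbrs⁺ : ∀ {v y} → v ~ y → P y → y ∈ nbrs P? v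
    ∈-nbrs⁺ v~y py = ∈-filter⁺ _ (∈-allFin _) (v~y , py)

    ∈-nbrs⁻ : ∀ {v y} → y ∈ nbrs P? v → v ~ y × P y
    ∈-nbrs⁻ y∈ = proj₂ (∈-filter⁻ _ {xs = allFin n} y∈)

    nbrs-unique : ∀ v → Unique (nbrs P? v)
    nbrs-unique v = filter⁺ _ (allFin⁺ n)

    nbrs-mono : ∀ {Q : Fin n → Set} (Q? : Decidable Q) {v} →
                (∀ {y} → v ~ y → P y → Q y) → length (nbrs P? v) ≤ length (nbrs Q? v)
    nbrs-mono Q? {v} P⇒Q = unique⊆⇒length≤ (nbrs-unique v) λ y∈ →
      let v~y , py = ∈-nbrs⁻ y∈ in ∈-filter⁺ _ (∈-allFin _) (v~y , P⇒Q v~y py)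

    -- For a neighbour w of v this is N[v] ∖ {w}, which has no more vertices than N(v).
    block : Fin n → Fin n → List (Fin n)
    block v w = v ∷ filter (λ y → ¬? (y ≟ w)) (nbrs P? v)

    length-block≤ : ∀ {v w} → v ~ w → P w → length (block v w) ≤ length (nbrs P? v)
    length-block≤ v~w pw = filter-notAll _ _ (lose (∈-nbrs⁺ v~w pw) λ w≢w → w≢w refl)

    ∈-block : ∀ {v w y} → P y → y ≡ v ⊎ v ~ y → y ≡ w ⊎ y ∈ block v w
    ∈-block py (inj₁ refl) = inj₂ (here refl)
    ∈-block {w = w} {y} py (inj₂ v~y) with y ≟ w
    ... | yes y≡w = inj₁ y≡w
    ... | no y≢w = inj₂ (there (∈-filter⁺ _ (∈-nbrs⁺ v~y py) y≢w))

    module _ (D : ℕ) where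

      Low : Fin n → Set
      Low v = P v × length (nbrs P? v) ≤ D

      Rest : Fin n → Set
      Rest v = P v × ¬ Low v

      Low? : Decidable Low
      Low? v = P? v ×-dec (length (nbrs P? v) ≤? D)

      Rest? : Decidable Rest
      Rest? v = P? v ×-dec ¬? (Low? v)

      low⊎rest : ∀ {v} → P v → Low v ⊎ Rest v
      low⊎rest {v} pv with Low? v
      ... | yes l = inj₁ l
      ... | no ¬l = inj₂ (pv , ¬l)

  lowRest⇒lowNbr : ∀ {P : Fin n → Set} (P? : Decidable P) D {w} → Low (Rest? P? D) D w →
                   ∃ λ v → Low P? D v × w ~ v
  lowRest⇒lowNbr P? D {w} ((pw , ¬low) , deg≤) with any? (λ v → Low? P? D v ×-dec (w ~? v))
  ... | yes found = found
  ... | no ∄v = contradiction (pw , ≤-trans (nbrs-mono P? (Rest? P? D) inRest) deg≤) ¬low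
    where
    inRest : ∀ {y} → w ~ y → _ → Rest P? D y
    inRest w~y py = py , λ low → ∄v (_ , low , w~y)

  module _ {P : Fin n → Set} (P? : Decidable P) where

    private
      inducedE : Fin n → Subset n
      inducedE u = subsetOf (λ y → P? u ×-dec ((u ~? y) ×-dec P? y))

      ∈E⁻ : ∀ {u y} → y ∈ₛ inducedE u → P u × u ~ y × P y
      ∈E⁻ {u} = ∈-subsetOf⁻ (λ y → P? u ×-dec ((u ~? y) ×-dec P? y))

      ∈E⁺ : ∀ {u y} → P u × u ~ y × P y → y ∈ₛ inducedE u
      ∈E⁺ {u} = ∈-subsetOf⁺ (λ y → P? u ×-dec ((u ~? y) ×-dec P? y))

    induced : Subgraph G
    induced = record
      { V     = subsetOf P?
      ; E     = inducedE
      ; E⊆    = λ u y∈ → proj₁ (proj₂ (∈E⁻ y∈))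
      ; Esym  = λ y∈ → let pu , u~y , py = ∈E⁻ y∈ in ∈E⁺ (py , ~-sym u~y , pu)
      ; Eends = λ y∈ → let pu , u~y , py = ∈E⁻ y∈ in ∈-subsetOf⁺ P? pu , ∈-subsetOf⁺ P? py
      }

    nbrs≤degInduced : ∀ {u} → P u → length (nbrs P? u) ≤ degH induced u
    nbrs≤degInduced pu = unique⇒length≤∣p∣ (nbrs-unique P? _) λ y∈ →
      let u~y , py = ∈-nbrs⁻ P? y∈ in ∈E⁺ (pu , u~y , py)

    -- If all degrees in G[P] exceeded D, then G[P] would force ζ v > D.
    peel : ∀ {ζ : Fin n → ℕ} → (∀ v → IsZeta G v (ζ v)) → ∀ {D v} → P v → ζ v ≤ D → ∃ (Low P? D)
    peel {ζ} isζ {D} {v} pv ζv≤D = x , px ,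
      ≤-trans (nbrs≤degInduced px) (≤-trans degx≤ζv ζv≤D)
      where
      Ps = filter P? (allFin n)
      x = argmin (degH induced) v Ps
      px : P x
      px = argmin-all (degH induced) pv (All.tabulate (λ y∈ → proj₂ (∈-filter⁻ P? {xs = allFin n} y∈)))
      degx≤ : ∀ u → u ∈ₛ V induced → degH induced x ≤ degH induced u
      degx≤ u u∈ = All.lookup (f[argmin]≤f[xs] v Ps) (∈-filter⁺ P? (∈-allFin u) (∈-subsetOf⁻ P? u∈))
      degx≤ζv : degH induced x ≤ ζ v
      degx≤ζv = proj₂ (isζ v) induced (degH induced x) (∈-subsetOf⁺ P? pv)
        ((x , ∈-subsetOf⁺ P? px , refl) , degx≤)

sum-map≤ : ∀ {A : Set} (c : A → ℕ) b l → (∀ {x} → x ∈ l → c x ≤ b) → sum (map c l) ≤ length l * b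
sum-map≤ c b [] _ = z≤n
sum-map≤ c b (x ∷ l) h = +-mono-≤ (h (here refl)) (sum-map≤ c b l (h ∘ there))

sum-map-++ : ∀ {A : Set} (c : A → ℕ) l m → sum (map c (l ++ m)) ≡ sum (map c l) + sum (map c m)
sum-map-++ c l m = trans (cong sum (map-++ c l m)) (sum-++ (map c l) (map c m))

length-concat≤ : ∀ {A : Set} b (ls : List (List A)) → All (λ l → length l ≤ b) ls →
                 length (concat ls) ≤ length ls * b
length-concat≤ b [] [] = z≤n
length-concat≤ b (l ∷ ls) (l≤b ∷ ls≤b) =
  ≤-trans (≤-reflexive (length-++ l)) (+-mono-≤ l≤b (length-concat≤ b ls ls≤b))

≡+⇒≤ : ∀ {a b} d → b ≡ a + d → a ≤ b
≡+⇒≤ {a} d refl = m≤m+n a d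

module _ {n : ℕ} (G : Graph n) (ζ : Fin n → ℕ)
         (noCheap : ∀ S → Nonempty S → ¬ IsCheap G ζ 2 S) where

  noIsolated : ∀ v → ∃ λ w → _~_ G v w
  noIsolated v with nonempty? (adj G v)
  ... | yes v~w = v~w
  ... | no empty = ⊥-elim (noCheap ⁅ v ⁆ (v , x∈⁅x⁆ v)
          (inj₁ λ u u∈ → subst (Isolated G) (sym (x∈⁅y⁆⇒x≡y v u∈)) empty))

  noCheapList : ∀ K (c : Fin n → ℕ) → 0 < K → (∀ x → K * 3 ≤ c x * (1 + 3 * ζ x)) →
                ∀ L M → Unique L → 0 < length L →
                (∀ {s y} → s ∈ L → y ≡ s ⊎ _~_ G s y → y ∈ M) →
                (∀ {s} → s ∈ L → ∃ λ l → length l ≤ 2 × (∀ {y} → y ∈ L → _~_ G s y → y ∈ l)) →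
                sum (map c M) ≤ K * length L → False
  noCheapList (suc k) c _ valid L@(s₀ ∷ _) M L! _ cover deg≤2 cost≤ = noCheap S (s₀ , ∈-fromList⁺ {l = L} (here refl))
    (inj₂ ((λ v _ → noIsolated v) , weight≤∣S∣ , λ v v∈ →
      let l , l≤2 , N⊆l = deg≤2 (∈-fromList⁻ L v∈) in
      ≤-trans (cover⇒∣p∣≤length λ y∈ →
        let y∈adj , y∈S = x∈p∩q⁻ (adj G v) S y∈ in N⊆l (∈-fromList⁻ L y∈S) y∈adj) l≤2))
    where
    S = fromList L
    N⊆M : ∀ {x} → x ∈ₛ closedNbhd G S → x ∈ M
    N⊆M x∈ with ∈-closedNbhd⁻ G S x∈
    ... | inj₁ x∈S = cover (∈-fromList⁻ L x∈S) (inj₁ refl)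
    ... | inj₂ (v , v∈S , v~x) = cover (∈-fromList⁻ L v∈S) (inj₂ v~x)
    weight≤∣S∣ : sumOver (closedNbhd G S) (λ v → weight 2 (ζ v)) ≤ℚ (+ ∣ S ∣ /ℚ 1)
    weight≤∣S∣ = sumOver-weight≤ (closedNbhd G S) ζ k c valid M ∣ S ∣ N⊆M
      (≤-trans cost≤ (*-monoʳ-≤ (suc k) (unique⇒length≤∣p∣ L! (∈-fromList⁺ {l = L}))))

-- Weights are scaled by K = 28 p (p + 3) with p = 3D + 1, a common multiple of the denominators 3z + 1 for
-- z = 1, 2, D, D + 1; levels above D are charged like D + 1.
module Costs (D : ℕ) where

  p r q K : ℕ
  p = 1 + 3 * D
  r = p + 3
  q = p * r
  K = 28 * q

  K>0 : 0 < K
  K>0 = s≤s z≤n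

  cost : ℕ → ℕ
  cost z with z <? D | D <? z
  ... | yes _ | _ = small z
    where
    small : ℕ → ℕ
    small 1 = 21 * q
    small 2 = 12 * q
    small _ = K * 3 -- never used: levels below D are 1 or 2
  ... | no _ | yes _ = 84 * p
  ... | no _ | no _ = 84 * r

  cost-valid : ∀ z → K * 3 ≤ cost z * (1 + 3 * z)
  cost-valid z with z <? D | D <? z
  ... | no _ | yes D<z = begin
    28 * (p * (p + 3)) * 3     ≡⟨ eq p ⟩
    84 * p * (p + 3)           ≡⟨ cong (84 * p *_) (eq′ D) ⟩
    84 * p * (1 + 3 * suc D)   ≤⟨ *-monoʳ-≤ (84 * p) (s≤s (*-monoʳ-≤ 3 D<z)) ⟩
    84 * p * (1 + 3 * z)       ∎
    where
    open ≤-Reasoning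
    eq : ∀ p → 28 * (p * (p + 3)) * 3 ≡ 84 * p * (p + 3)
    eq = solve-∀
    eq′ : ∀ D → 1 + 3 * D + 3 ≡ 1 + 3 * suc D
    eq′ = solve-∀
  ... | no z≮D | no D≮z with ≤-antisym (≮⇒≥ D≮z) (≮⇒≥ z≮D)
  ...   | refl = ≤-reflexive (eq p r)
    where
    eq : ∀ p r → 28 * (p * r) * 3 ≡ 84 * r * p
    eq = solve-∀
  cost-valid 0 | yes _ | _ = ≤-reflexive (sym (*-identityʳ _))
  cost-valid 1 | yes _ | _ = ≤-reflexive (eq q)
    where
    eq : ∀ q → 28 * q * 3 ≡ 21 * q * 4
    eq = solve-∀
  cost-valid 2 | yes _ | _ = ≤-reflexive (eq q)
    where
    eq : ∀ q → 28 * q * 3 ≡ 12 * q * 7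
    eq = solve-∀
  cost-valid z@(suc (suc (suc _))) | yes _ | _ = m≤m*n (K * 3) (1 + 3 * z)

  cost-high : ∀ {z} → D < z → cost z ≤ 84 * p
  cost-high {z} D<z with z <? D | D <? z
  ... | yes z<D | _ = contradiction D<z (<-asym z<D)
  ... | no _ | yes _ = ≤-refl
  ... | no _ | no D≮z = contradiction D<z D≮z

  cost≤84r : ∀ {z} → D ≤ z → cost z ≤ 84 * r
  cost≤84r {z} D≤z with z <? D | D <? z
  ... | yes z<D | _ = contradiction D≤z (<⇒≱ z<D)
  ... | no _ | yes _ = *-monoʳ-≤ 84 (m≤m+n p 3)
  ... | no _ | no _ = ≤-refl

  -- A vertex with ζ = z < D pays for itself and for z − 1 more vertices of weight at most 84 r,
  -- and 42 r is left over.
  cost-low : ∀ {z m} → z < D → z ≤ 2 → suc m ≤ z → cost z + m * (84 * r) + 42 * r ≤ K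
  cost-low {z} z<D _ _ with z <? D | D <? z
  ... | no z≮D | _ = contradiction z<D z≮D
  cost-low {1} {0} (s≤s (s≤s {n = t} _)) _ (s≤s z≤n) | yes _ | _ = ≡+⇒≤ _ (eq t r)
    where
    eq : ∀ t r → 28 * ((1 + 3 * (2 + t)) * r) ≡ 21 * ((1 + 3 * (2 + t)) * r) + 0 + 42 * r + (7 + 21 * t) * r
    eq = solve-∀
  cost-low {2} {m} (s≤s (s≤s (s≤s {n = t} _))) _ (s≤s m≤1) | yes _ | _ = begin
    12 * q + m * (84 * r) + 42 * r ≤⟨ +-monoˡ-≤ (42 * r) (+-monoʳ-≤ (12 * q) (*-monoˡ-≤ (84 * r) m≤1)) ⟩
    12 * q + 1 * (84 * r) + 42 * r ≤⟨ ≡+⇒≤ _ (eq t r) ⟩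
    K                              ∎
    where
    open ≤-Reasoning
    eq : ∀ t r → 28 * ((1 + 3 * (3 + t)) * r) ≡ 12 * ((1 + 3 * (3 + t)) * r) + 1 * (84 * r) + 42 * r + (34 + 48 * t) * r
    eq = solve-∀
  cost-low {suc (suc (suc _))} _ (s≤s (s≤s ())) _ | yes _ | _

from : ∀ k (F : ℕ → Set) → (∀ t → F (k + t)) → ∀ {D} → k ≤ D → F D
from k F f k≤D = subst F (m+[n∸m]≡n k≤D) (f _)

pair-budget : ∀ {D} → 1 ≤ D → let p = 1 + 3 * D; r = p + 3 in
              84 * r + (D * (84 * r) + D * (84 * p)) ≤ 28 * (p * r) * 2
pair-budget = from 1
  (λ D → let p = 1 + 3 * D; r = p + 3 in 84 * r + (D * (84 * r) + D * (84 * p)) ≤ 28 * (p * r) * 2)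
  λ t → ≡+⇒≤ (56 + 168 * t) (eq t)
  where
  eq : ∀ t → let D = 1 + t; p = 1 + 3 * D; r = p + 3 in
       28 * (p * r) * 2 ≡ 84 * r + (D * (84 * r) + D * (84 * p)) + (56 + 168 * t)
  eq = solve-∀

single-budget : ∀ {D} → 3 ≤ D → let p = 1 + 3 * D; r = p + 3 in
                84 * r + D * (84 * p) ≤ 28 * (p * r) * 1
single-budget = from 3
  (λ D → let p = 1 + 3 * D; r = p + 3 in 84 * r + D * (84 * p) ≤ 28 * (p * r) * 1)
  λ t → ≡+⇒≤ (28 + 84 * t) (eq t)
  where
  eq : ∀ t → let D = 3 + t; p = 1 + 3 * D; r = p + 3 in
       28 * (p * r) * 1 ≡ 84 * r + D * (84 * p) + (28 + 84 * t)
  eq = solve-∀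

single-budget-hanging : ∀ {D} → 1 ≤ D → let p = 1 + 3 * D; r = p + 3 in
                        84 * r + D * (84 * p) ≤ 28 * (p * r) * 1 + 1 * (42 * r)
single-budget-hanging = from 1
  (λ D → let p = 1 + 3 * D; r = p + 3 in 84 * r + D * (84 * p) ≤ 28 * (p * r) * 1 + 1 * (42 * r))
  λ t → ≡+⇒≤ (154 + 210 * t) (eq t)
  where
  eq : ∀ t → let D = 1 + t; p = 1 + 3 * D; r = p + 3 in
       28 * (p * r) * 1 + 1 * (42 * r) ≡ 84 * r + D * (84 * p) + (154 + 210 * t)
  eq = solve-∀

record Peeled {n : ℕ} (G : Graph n) (ζ : Fin n → ℕ) (D : ℕ) : Set where
  field
    deg≤ζ   : ∀ {a} → ζ a < D → length (nbrs G U? a) ≤ ζ a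
    ζ≤2     : ∀ {a} → ζ a < D → ζ a ≤ 2
    nbrHigh : ∀ {a b} → ζ a < D → _~_ G a b → D ≤ ζ b

module Level {n : ℕ} (G : Graph n) (ζ : Fin n → ℕ)
             (noCheap : ∀ S → Nonempty S → ¬ IsCheap G ζ 2 S)
             (D : ℕ) (peeled : Peeled G ζ D) where

  open Costs D
  open Peeled peeled
  open import Data.List.Membership.DecPropositional (_≟_ {n}) using (_∈?_)

  infix 4 _∼_
  _∼_ : Fin n → Fin n → Set
  _∼_ = _~_ G

  hangs? : ∀ C → Decidable (λ a → ζ a < D × Any (a ∼_) C)
  hangs? C a = (ζ a <? D) ×-dec Any.any? (_~?_ G a) C

  hanging : List (Fin n) → List (Fin n)
  hanging C = filter (hangs? C) (allFin n)

  ∈-hanging⁺ : ∀ {C a y} → ζ a < D → y ∈ C → a ∼ y → a ∈ hanging C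
  ∈-hanging⁺ {C} a<D y∈C a∼y = ∈-filter⁺ (hangs? C) (∈-allFin _) (a<D , lose y∈C a∼y)

  ∈-hanging⁻ : ∀ {C a} → a ∈ hanging C → ζ a < D × Any (a ∼_) C
  ∈-hanging⁻ {C} a∈ = proj₂ (∈-filter⁻ (hangs? C) {xs = allFin n} a∈)

  c : Fin n → ℕ
  c = cost ∘ ζ

  -- All vertices below level D next to C join S: each of them more than pays for itself and its
  -- neighbours outside C.
  hangingNoCheap : ∀ S C → Unique S → (∀ {s} → s ∈ S → D ≤ ζ s) →
    (∀ {s y} → s ∈ S → D ≤ ζ y → y ≡ s ⊎ s ∼ y → y ∈ C) →
    (∀ {s} → s ∈ S → ∃ λ l → length l ≤ 2 × (∀ {y} → s ∼ y → y ∈ S ⊎ ζ y < D → y ∈ l)) →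
    0 < length S + length (hanging C) →
    sum (map c C) ≤ K * length S + length (hanging C) * (42 * r) → False
  hangingNoCheap S C S! high cover deg≤2 nonempty cost≤ =
    noCheapList G ζ noCheap K c K>0 (cost-valid ∘ ζ) (S ++ H) (C ++ concatMap claim H)
      (++⁺ S! (filter⁺ (hangs? C) (allFin⁺ n)) λ (x∈S , x∈H) →
        <⇒≱ (proj₁ (∈-hanging⁻ {C} x∈H)) (high x∈S))
      (subst (0 <_) (sym (length-++ S)) nonempty) cover′ deg≤2′ cost≤′
    where
    H = hanging C

    outside : Fin n → List (Fin n)
    outside t = filter (λ y → ¬? (y ∈? C)) (nbrs G U? t)

    claim : Fin n → List (Fin n)
    claim t = t ∷ outside t

    cover′ : ∀ {s y} → s ∈ S ++ H → y ≡ s ⊎ s ∼ y → y ∈ C ++ concatMap claim H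
    cover′ {s} {y} s∈ h with ∈-++⁻ S s∈
    cover′ {s} {y} s∈ h | inj₁ s∈S with D ≤? ζ y
    ... | yes D≤ζy = ∈-++⁺ˡ (cover s∈S D≤ζy h)
    cover′ s∈ (inj₁ refl) | inj₁ s∈S | no D≰ζy = contradiction (high s∈S) D≰ζy
    cover′ s∈ (inj₂ s∼y) | inj₁ s∈S | no D≰ζy = ∈-++⁺ʳ C (∈-concatMap⁺ claim
      (lose (∈-hanging⁺ (≰⇒> D≰ζy) (cover s∈S (high s∈S) (inj₁ refl)) (~-sym G s∼y)) (here refl)))
    cover′ s∈ (inj₁ refl) | inj₂ s∈H = ∈-++⁺ʳ C (∈-concatMap⁺ claim (lose s∈H (here refl)))
    cover′ {s} {y} s∈ (inj₂ s∼y) | inj₂ s∈H with y ∈? C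
    ... | yes y∈C = ∈-++⁺ˡ y∈C
    ... | no y∉C = ∈-++⁺ʳ C (∈-concatMap⁺ claim
      (lose s∈H (there (∈-filter⁺ _ (∈-nbrs⁺ G U? s∼y _) y∉C))))

    deg≤2′ : ∀ {s} → s ∈ S ++ H → ∃ λ l → length l ≤ 2 × (∀ {y} → y ∈ S ++ H → s ∼ y → y ∈ l)
    deg≤2′ {s} s∈ with ∈-++⁻ S s∈
    ... | inj₁ s∈S = let l , l≤2 , N⊆l = deg≤2 s∈S in l , l≤2 , λ y∈ s∼y → N⊆l s∼y (split (∈-++⁻ S y∈))
      where
      split : ∀ {y} → y ∈ S ⊎ y ∈ H → y ∈ S ⊎ ζ y < D
      split (inj₁ y∈S) = inj₁ y∈S
      split (inj₂ y∈H) = inj₂ (proj₁ (∈-hanging⁻ {C} y∈H))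
    ... | inj₂ s∈H = let s<D = proj₁ (∈-hanging⁻ {C} s∈H) in
      nbrs G U? s , ≤-trans (deg≤ζ s<D) (ζ≤2 s<D) , λ _ s∼y → ∈-nbrs⁺ G U? s∼y _

    claim-cost : ∀ {t} → t ∈ H → sum (map c (claim t)) + 42 * r ≤ K
    claim-cost {t} t∈H = begin
      c t + sum (map c (outside t)) + 42 * r        ≤⟨ +-monoˡ-≤ (42 * r) (+-monoʳ-≤ (c t) outside-cost) ⟩
      c t + length (outside t) * (84 * r) + 42 * r  ≤⟨ cost-low t<D (ζ≤2 t<D) (≤-trans outside< (deg≤ζ t<D)) ⟩
      K                                             ∎
      where
      open ≤-Reasoning
      t<D = proj₁ (∈-hanging⁻ {C} t∈H)
      outside-cost = sum-map≤ c (84 * r) (outside t) λ y∈ → cost≤84r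
        (nbrHigh t<D (proj₁ (∈-nbrs⁻ G U? (proj₁ (∈-filter⁻ _ {xs = nbrs G U? t} y∈)))))
      outside< : suc (length (outside t)) ≤ length (nbrs G U? t)
      outside< with find (proj₂ (∈-hanging⁻ {C} t∈H))
      ... | y , y∈C , t∼y = filter-notAll _ _ (lose (∈-nbrs⁺ G U? t∼y _) λ y∉C → y∉C y∈C)

    claims-cost : ∀ T → (∀ {t} → t ∈ T → t ∈ H) →
                  sum (map c (concatMap claim T)) + length T * (42 * r) ≤ length T * K
    claims-cost [] _ = z≤n
    claims-cost (t ∷ T) T⊆H = begin
      sum (map c (claim t ++ concatMap claim T)) + (42 * r + length T * (42 * r))
        ≡⟨ cong (_+ (42 * r + length T * (42 * r))) (sum-map-++ c (claim t) (concatMap claim T)) ⟩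
      sum (map c (claim t)) + sum (map c (concatMap claim T)) + (42 * r + length T * (42 * r))
        ≡⟨ eq (sum (map c (claim t))) _ (42 * r) _ ⟩
      (sum (map c (claim t)) + 42 * r) + (sum (map c (concatMap claim T)) + length T * (42 * r))
        ≤⟨ +-mono-≤ (claim-cost (T⊆H (here refl))) (claims-cost T (T⊆H ∘ there)) ⟩
      K + length T * K ∎
      where
      open ≤-Reasoning
      eq : ∀ a b c d → a + b + (c + d) ≡ (a + c) + (b + d)
      eq = solve-∀

    cost≤′ : sum (map c (C ++ concatMap claim H)) ≤ K * length (S ++ H)
    cost≤′ = +-cancelʳ-≤ (length H * (42 * r)) _ _ (begin
      sum (map c (C ++ concatMap claim H)) + length H * (42 * r)
        ≡⟨ cong (_+ length H * (42 * r)) (sum-map-++ c C (concatMap claim H)) ⟩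
      sum (map c C) + sum (map c (concatMap claim H)) + length H * (42 * r)
        ≡⟨ +-assoc (sum (map c C)) _ _ ⟩
      sum (map c C) + (sum (map c (concatMap claim H)) + length H * (42 * r))
        ≤⟨ +-mono-≤ cost≤ (claims-cost H id) ⟩
      K * length S + length H * (42 * r) + length H * K
        ≡⟨ eq (length S) (length H) (42 * r) K ⟩
      K * (length S + length H) + length H * (42 * r)
        ≡⟨ cong (λ m → K * m + length H * (42 * r)) (length-++ S) ⟨
      K * length (S ++ H) + length H * (42 * r) ∎)
      where
      open ≤-Reasoning
      eq : ∀ s h e K → K * s + h * e + h * K ≡ K * (s + h) + h * e
      eq = solve-∀

  lowNbr-unique : ∀ {y a b} → D ≤ ζ y → ζ a < D → ζ b < D → y ∼ a → y ∼ b → a ≡ b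
  lowNbr-unique {y} {a} {b} D≤ζy a<D b<D y∼a y∼b with a ≟ b
  ... | yes a≡b = a≡b
  ... | no a≢b = ⊥-elim (hangingNoCheap [] [ y ] [] (λ ()) (λ ()) (λ ()) (<-≤-trans (s≤s z≤n) two) (begin
      c y + 0                             ≡⟨ +-identityʳ (c y) ⟩
      c y                                 ≤⟨ cost≤84r D≤ζy ⟩
      84 * r                              ≡⟨ eq r ⟩
      2 * (42 * r)                        ≤⟨ *-monoˡ-≤ (42 * r) two ⟩
      length (hanging [ y ]) * (42 * r)   ≤⟨ m≤n+m _ (K * 0) ⟩
      K * 0 + length (hanging [ y ]) * (42 * r) ∎))
    where
    open ≤-Reasoning
    eq : ∀ r → 84 * r ≡ 2 * (42 * r)
    eq = solve-∀
    two : 2 ≤ length (hanging [ y ])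
    two = unique⊆⇒length≤ ((a≢b ∷ []) ∷ [] ∷ []) λ where
      (here refl) → ∈-hanging⁺ a<D (here refl) (~-sym G y∼a)
      (there (here refl)) → ∈-hanging⁺ b<D (here refl) (~-sym G y∼b)

  -- A vertex of S has at most one neighbour below level D, which may join S.
  SparseIn : List (Fin n) → Fin n → Set
  SparseIn S s = ∃ λ l → (length l ≤ 1 ⊎ length l ≤ 2 × (∀ {a} → s ∼ a → D ≤ ζ a)) ×
                         (∀ {y} → y ∈ S → s ∼ y → y ∈ l)

  sparse⇒deg≤2 : ∀ {S s} → D ≤ ζ s → SparseIn S s →
                 ∃ λ l → length l ≤ 2 × (∀ {y} → s ∼ y → y ∈ S ⊎ ζ y < D → y ∈ l)
  sparse⇒deg≤2 _ (l , inj₂ (l≤2 , noLow) , N⊆l) = l , l≤2 , λ where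
    s∼y (inj₁ y∈S) → N⊆l y∈S s∼y
    s∼y (inj₂ y<D) → contradiction (noLow s∼y) (<⇒≱ y<D)
  sparse⇒deg≤2 {s = s} D≤ζs (l , inj₁ l≤1 , N⊆l) with any? (λ a → (ζ a <? D) ×-dec _~?_ G s a)
  ... | yes (a , a<D , s∼a) = a ∷ l , s≤s l≤1 , λ where
    s∼y (inj₁ y∈S) → there (N⊆l y∈S s∼y)
    s∼y (inj₂ y<D) → here (lowNbr-unique D≤ζs y<D a<D s∼y s∼a)
  ... | no ∄a = l , ≤-trans l≤1 (s≤s z≤n) , λ where
    s∼y (inj₁ y∈S) → N⊆l y∈S s∼y
    s∼y (inj₂ y<D) → contradiction (_ , y<D , s∼y) ∄a

  LowNbrIn : List (Fin n) → Set
  LowNbrIn C = ∃₂ λ a y → ζ a < D × D ≤ ζ y × y ∈ C × a ∼ y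

  -- Why |S| blocks of size D and about |S|/3 extra vertices zs are affordable: K is 28 (3D + 1) r and each vertex
  -- costs at most 84 r.
  blocksNoCheap : ∀ S zs bs → Unique S → (∀ {s} → s ∈ S → D ≤ ζ s) → 0 < length S →
    length bs ≡ length S → All (λ b → length b ≤ D) bs →
    (∀ {s y} → s ∈ S → D ≤ ζ y → y ≡ s ⊎ s ∼ y → Any (y ∈_) (zs ∷ bs)) →
    (∀ {s} → s ∈ S → SparseIn S s) →
    6 * length zs ≤ 2 * length S ⊎ 6 * length zs ≤ 2 * length S + 3 × LowNbrIn (concat (zs ∷ bs)) → False
  blocksNoCheap S zs bs S! high nonempty ∣bs∣≡∣S∣ bs≤D cover sparse budget =
    hangingNoCheap S C S! high
      (λ s∈S D≤ζy h → ∈-filter⁺ _ (concat⁺ (cover s∈S D≤ζy h)) D≤ζy)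
      (λ s∈S → sparse⇒deg≤2 (high s∈S) (sparse s∈S)) (≤-trans nonempty (m≤m+n _ _)) (begin
      sum (map c C)                               ≤⟨ sum-map≤ c (84 * r) C (λ y∈ → cost≤84r (proj₂ (∈-filter⁻ _ {xs = concat (zs ∷ bs)} y∈))) ⟩
      length C * (84 * r)                         ≤⟨ *-monoˡ-≤ (84 * r) ∣C∣≤ ⟩
      (length zs + length S * D) * (84 * r)       ≡⟨ eq₁ (length zs) (length S) D r ⟩
      6 * length zs * (14 * r) + 84 * length S * D * r                   ≤⟨ +-monoˡ-≤ _ (*-monoˡ-≤ (14 * r) budget′) ⟩
      (2 * length S + 3 * h) * (14 * r) + 84 * length S * D * r          ≡⟨ eq₂ (length S) h D r ⟩
      28 * ((1 + 3 * D) * r) * length S + h * (42 * r)                   ∎)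
    where
    open ≤-Reasoning
    C = filter (λ y → D ≤? ζ y) (concat (zs ∷ bs))
    h = length (hanging C)
    eq₁ : ∀ z s D r → (z + s * D) * (84 * r) ≡ 6 * z * (14 * r) + 84 * s * D * r
    eq₁ = solve-∀
    eq₂ : ∀ s h D r → (2 * s + 3 * h) * (14 * r) + 84 * s * D * r ≡ 28 * ((1 + 3 * D) * r) * s + h * (42 * r)
    eq₂ = solve-∀
    ∣C∣≤ : length C ≤ length zs + length S * D
    ∣C∣≤ = begin
      length C                        ≤⟨ length-filter _ (concat (zs ∷ bs)) ⟩
      length (zs ++ concat bs)        ≡⟨ length-++ zs ⟩
      length zs + length (concat bs)  ≤⟨ +-monoʳ-≤ (length zs) (length-concat≤ D bs bs≤D) ⟩
      length zs + length bs * D       ≡⟨ cong (λ m → length zs + m * D) ∣bs∣≡∣S∣ ⟩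
      length zs + length S * D        ∎
    h>0 : LowNbrIn (concat (zs ∷ bs)) → 1 ≤ h
    h>0 (a , y , a<D , D≤ζy , y∈ , a∼y) = unique⊆⇒length≤ ([] ∷ []) λ where
      (here refl) → ∈-hanging⁺ a<D (∈-filter⁺ _ y∈ D≤ζy) a∼y
    budget′ : 6 * length zs ≤ 2 * length S + 3 * h
    budget′ = Sum.[_,_]′ (λ le → ≤-trans le (m≤m+n _ _))
      (λ (le , low) → ≤-trans le (+-monoʳ-≤ (2 * length S) (*-monoʳ-≤ 3 (h>0 low)))) budget

  High? : Decidable (λ v → D ≤ ζ v)
  High? v = D ≤? ζ v

  L₁ L₂ L₃ : Fin n → Set
  P₂? : Decidable (Rest G High? D)
  P₃? : Decidable (Rest G P₂? D)
  L₁ = Low G High? D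
  P₂? = Rest? G High? D
  L₂ = Low G P₂? D
  P₃? = Rest? G P₂? D
  L₃ = Low G P₃? D

  ∼⇒≢ : ∀ {u v} → u ∼ v → u ≢ v
  ∼⇒≢ u∼v refl = ~-irrefl G u∼v

  hub : ∀ {w y : Fin n} {b bs} → y ≡ w ⊎ y ∈ b → b ∈ bs → Any (y ∈_) ([ w ] ∷ bs)
  hub (inj₁ refl) _ = here (here refl)
  hub (inj₂ y∈b) b∈ = there (lose b∈ y∈b)

  L₁-independent : ∀ {v v′} → L₁ v → L₁ v′ → ¬ v ∼ v′
  L₁-independent {v} {v′} lv lv′ v∼v′ =
    blocksNoCheap (v ∷ v′ ∷ []) [] (nbrs G High? v ∷ nbrs G High? v′ ∷ []) ((∼⇒≢ v∼v′ ∷ []) ∷ [] ∷ [])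
      (λ { (here refl) → proj₁ lv ; (there (here refl)) → proj₁ lv′ })
      (s≤s z≤n) refl (proj₂ lv ∷ proj₂ lv′ ∷ [])
      (λ where
        (here refl) D≤ (inj₁ refl) → there (there (here (∈-nbrs⁺ G High? v′∼v D≤)))
        (here refl) D≤ (inj₂ v∼y) → there (here (∈-nbrs⁺ G High? v∼y D≤))
        (there (here refl)) D≤ (inj₁ refl) → there (here (∈-nbrs⁺ G High? v∼v′ D≤))
        (there (here refl)) D≤ (inj₂ v′∼y) → there (there (here (∈-nbrs⁺ G High? v′∼y D≤))))
      (λ where
        (here refl) → [ v′ ] , inj₁ (s≤s z≤n) , λ where
          (here refl) v∼v → contradiction v∼v (~-irrefl G)
          (there y∈) _ → y∈
        (there (here refl)) → [ v ] , inj₁ (s≤s z≤n) , λ where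
          (here refl) _ → here refl
          (there (here refl)) v′∼v′ → contradiction v′∼v′ (~-irrefl G))
      (inj₁ z≤n)
    where v′∼v = ~-sym G v∼v′

  L₁-sparse : ∀ {S s} → All L₁ S → s ∈ S → SparseIn S s
  L₁-sparse lS s∈S = [] , inj₁ z≤n , λ y∈S s∼y →
    contradiction s∼y (L₁-independent (All.lookup lS s∈S) (All.lookup lS y∈S))

  length-block₁≤ : ∀ {v w} → L₁ v → D ≤ ζ w → w ∼ v → length (block G High? v w) ≤ D
  length-block₁≤ lv D≤ζw w∼v = ≤-trans (length-block≤ G High? (~-sym G w∼v) D≤ζw) (proj₂ lv)

  noThreeL₁Nbrs : ∀ {w v₁ v₂ v₃} → D ≤ ζ w → L₁ v₁ → L₁ v₂ → L₁ v₃ → w ∼ v₁ → w ∼ v₂ → w ∼ v₃ →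
                  v₁ ≢ v₂ → v₁ ≢ v₃ → v₂ ≢ v₃ → False
  noThreeL₁Nbrs {w} {v₁} {v₂} {v₃} D≤ζw l₁ l₂ l₃ a₁ a₂ a₃ n₁₂ n₁₃ n₂₃ =
    blocksNoCheap (v₁ ∷ v₂ ∷ v₃ ∷ []) [ w ] (block G High? v₁ w ∷ block G High? v₂ w ∷ block G High? v₃ w ∷ [])
      ((n₁₂ ∷ n₁₃ ∷ []) ∷ (n₂₃ ∷ []) ∷ [] ∷ []) (proj₁ ∘ All.lookup ls) (s≤s z≤n) refl
      (length-block₁≤ l₁ D≤ζw a₁ ∷ length-block₁≤ l₂ D≤ζw a₂ ∷ length-block₁≤ l₃ D≤ζw a₃ ∷ [])
      (λ where
        (here refl) D≤ h → hub (∈-block G High? D≤ h) (here refl)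
        (there (here refl)) D≤ h → hub (∈-block G High? D≤ h) (there (here refl))
        (there (there (here refl))) D≤ h → hub (∈-block G High? D≤ h) (there (there (here refl))))
      (L₁-sparse ls) (inj₁ ≤-refl)
    where
    ls : All L₁ (v₁ ∷ v₂ ∷ v₃ ∷ [])
    ls = l₁ ∷ l₂ ∷ l₃ ∷ []

  noTwoL₁Nbrs : ∀ {w v₁ v₂} → L₂ w → L₁ v₁ → L₁ v₂ → w ∼ v₁ → w ∼ v₂ → v₁ ≢ v₂ → False
  noTwoL₁Nbrs {w} {v₁} {v₂} ((D≤ζw , ¬l) , deg≤) l₁ l₂ a₁ a₂ n₁₂
    with any? (λ a → (ζ a <? D) ×-dec _~?_ G a w)
  ... | yes (a , a<D , a∼w) =
    blocksNoCheap (v₁ ∷ v₂ ∷ []) [ w ] (block G High? v₁ w ∷ block G High? v₂ w ∷ [])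
      ((n₁₂ ∷ []) ∷ [] ∷ []) (proj₁ ∘ All.lookup ls) (s≤s z≤n) refl
      (length-block₁≤ l₁ D≤ζw a₁ ∷ length-block₁≤ l₂ D≤ζw a₂ ∷ [])
      (λ where
        (here refl) D≤ h → hub (∈-block G High? D≤ h) (here refl)
        (there (here refl)) D≤ h → hub (∈-block G High? D≤ h) (there (here refl)))
      (L₁-sparse ls) (inj₂ (m≤m+n 6 1 , a , w , a<D , D≤ζw , here refl , a∼w))
    where
    ls : All L₁ (v₁ ∷ v₂ ∷ [])
    ls = l₁ ∷ l₂ ∷ []
  ... | no ∄a =
    blocksNoCheap (w ∷ v₁ ∷ v₂ ∷ []) [ w ] (nbrs G P₂? w ∷ block G High? v₁ w ∷ block G High? v₂ w ∷ [])
      ((∼⇒≢ a₁ ∷ ∼⇒≢ a₂ ∷ []) ∷ (n₁₂ ∷ []) ∷ [] ∷ [])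
      (λ { (here refl) → D≤ζw ; (there (here refl)) → proj₁ l₁ ; (there (there (here refl))) → proj₁ l₂ })
      (s≤s z≤n) refl
      (deg≤ ∷ length-block₁≤ l₁ D≤ζw a₁ ∷ length-block₁≤ l₂ D≤ζw a₂ ∷ [])
      (λ where
        (here refl) _ (inj₁ refl) → here (here refl)
        (here refl) D≤ (inj₂ w∼y) → coverNbr w∼y (low⊎rest G High? D D≤)
        (there (here refl)) D≤ h → hub (∈-block G High? D≤ h) (there (here refl))
        (there (there (here refl))) D≤ h → hub (∈-block G High? D≤ h) (there (there (here refl))))
      (λ where
        (here refl) → v₁ ∷ v₂ ∷ [] , inj₂ (≤-refl , λ w∼a → ≮⇒≥ λ a<D → ∄a (_ , a<D , ~-sym G w∼a)) , λ where
          (here refl) w∼w → contradiction w∼w (~-irrefl G)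
          (there y∈) _ → y∈
        (there (here refl)) → [ w ] , inj₁ ≤-refl , λ where
          (here refl) _ → here refl
          (there (here refl)) v∼v → contradiction v∼v (~-irrefl G)
          (there (there (here refl))) v∼v → contradiction v∼v (L₁-independent l₁ l₂)
        (there (there (here refl))) → [ w ] , inj₁ ≤-refl , λ where
          (here refl) _ → here refl
          (there (here refl)) v∼v → contradiction v∼v (L₁-independent l₂ l₁)
          (there (there (here refl))) v∼v → contradiction v∼v (~-irrefl G))
      (inj₁ ≤-refl)
    where
    bs = nbrs G P₂? w ∷ block G High? v₁ w ∷ block G High? v₂ w ∷ []
    coverNbr : ∀ {y} → w ∼ y → L₁ y ⊎ Rest G High? D y → Any (y ∈_) ([ w ] ∷ bs)
    coverNbr w∼y (inj₂ py) = there (here (∈-nbrs⁺ G P₂? w∼y py))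
    coverNbr {y} w∼y (inj₁ ly) with v₁ ≟ y | v₂ ≟ y
    ... | yes refl | _ = there (there (here (here refl)))
    ... | no _ | yes refl = there (there (there (here (here refl))))
    ... | no v₁≢y | no v₂≢y = ⊥-elim (noThreeL₁Nbrs D≤ζw l₁ l₂ ly a₁ a₂ w∼y n₁₂ v₁≢y v₂≢y)

  L₁Nbr-unique : ∀ {w v v′} → L₂ w → L₁ v → L₁ v′ → w ∼ v → w ∼ v′ → v ≡ v′
  L₁Nbr-unique {v = v} {v′} lw lv lv′ w∼v w∼v′ with v ≟ v′
  ... | yes v≡v′ = v≡v′
  ... | no v≢v′ = ⊥-elim (noTwoL₁Nbrs lw lv lv′ w∼v w∼v′ v≢v′)

  L₁≢P₂ : ∀ {v w} → L₁ v → Rest G High? D w → v ≢ w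
  L₁≢P₂ lv (_ , ¬lw) refl = ¬lw lv

  L₂⇒High : ∀ {w} → L₂ w → D ≤ ζ w
  L₂⇒High ((D≤ζw , _) , _) = D≤ζw

  record Pair (v w : Fin n) : Set where
    field
      low₁ : L₁ v
      low₂ : L₂ w
      edge : w ∼ v

    edge′ : v ∼ w
    edge′ = ~-sym G edge

    v≢w : v ≢ w
    v≢w = L₁≢P₂ low₁ (proj₁ low₂)

    splitNbr : ∀ {y} → D ≤ ζ y → w ∼ y → y ≡ v ⊎ Rest G High? D y
    splitNbr D≤ζy w∼y with low⊎rest G High? D D≤ζy
    ... | inj₁ ly = inj₁ (L₁Nbr-unique low₂ ly low₁ w∼y edge)
    ... | inj₂ py = inj₂ py

    b₁ b₂ : List (Fin n)
    b₁ = block G High? v w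
    b₂ = nbrs G P₂? w

    ∣b₁∣≤D : length b₁ ≤ D
    ∣b₁∣≤D = length-block₁≤ low₁ (L₂⇒High low₂) edge

    cover₁ : ∀ {y bs} → D ≤ ζ y → y ≡ v ⊎ v ∼ y → Any (y ∈_) ([ w ] ∷ b₁ ∷ b₂ ∷ bs)
    cover₁ D≤ h = hub (∈-block G High? D≤ h) (here refl)

    cover₂ : ∀ {y bs} → D ≤ ζ y → y ≡ w ⊎ w ∼ y → Any (y ∈_) ([ w ] ∷ b₁ ∷ b₂ ∷ bs)
    cover₂ _ (inj₁ refl) = here (here refl)
    cover₂ D≤ (inj₂ w∼y) with splitNbr D≤ w∼y
    ... | inj₁ refl = there (here (here refl))
    ... | inj₂ py = there (there (here (∈-nbrs⁺ G P₂? w∼y py)))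

    noLowNbr : ∀ {a y} → D ≤ ζ y → (y ≡ v ⊎ v ∼ y) ⊎ (y ≡ w ⊎ w ∼ y) → y ∼ a → D ≤ ζ a
    noLowNbr {a} {y} D≤ζy y∈N y∼a = ≮⇒≥ λ a<D →
      blocksNoCheap (v ∷ w ∷ []) [ w ] (b₁ ∷ b₂ ∷ []) ((v≢w ∷ []) ∷ [] ∷ [])
        (λ { (here refl) → proj₁ low₁ ; (there (here refl)) → L₂⇒High low₂ })
        (s≤s z≤n) refl (∣b₁∣≤D ∷ proj₂ low₂ ∷ [])
        (λ { (here refl) → cover₁ ; (there (here refl)) → cover₂ })
        (λ where
          (here refl) → [ w ] , inj₁ ≤-refl , λ where
            (here refl) v∼v → contradiction v∼v (~-irrefl G)
            (there y∈) _ → y∈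
          (there (here refl)) → [ v ] , inj₁ ≤-refl , λ where
            (here refl) _ → here refl
            (there (here refl)) w∼w → contradiction w∼w (~-irrefl G))
        (inj₂ (m≤m+n 6 1 , a , y , a<D , D≤ζy , concat⁺ (Sum.[_,_]′ (cover₁ {bs = []} D≤ζy) (cover₂ D≤ζy) y∈N) , ~-sym G y∼a))

    noLowNbr₁ : ∀ {a} → v ∼ a → D ≤ ζ a
    noLowNbr₁ = noLowNbr (proj₁ low₁) (inj₁ (inj₁ refl))

    noLowNbr₂ : ∀ {a} → w ∼ a → D ≤ ζ a
    noLowNbr₂ = noLowNbr (L₂⇒High low₂) (inj₂ (inj₁ refl))

  pairOf : ∀ {w} → L₂ w → ∃ λ v → Pair v w
  pairOf lw = let v , lv , w∼v = lowRest⇒lowNbr G High? D lw in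
    v , record { low₁ = lv ; low₂ = lw ; edge = w∼v }

  L₂-independent : ∀ {w w′} → L₂ w → L₂ w′ → ¬ w ∼ w′
  L₂-independent {w} {w′} lw lw′ w∼w′ with pairOf lw | pairOf lw′
  ... | v , vw | v′ , v′w′ =
    blocksNoCheap (v ∷ w ∷ w′ ∷ []) [ v′ ] (P.b₁ ∷ P.b₂ ∷ P′.b₂ ∷ [])
      ((P.v≢w ∷ L₁≢P₂ P.low₁ (proj₁ lw′) ∷ []) ∷ (∼⇒≢ w∼w′ ∷ []) ∷ [] ∷ [])
      (λ { (here refl) → proj₁ P.low₁ ; (there (here refl)) → L₂⇒High lw ; (there (there (here refl))) → L₂⇒High lw′ })
      (s≤s z≤n) refl (P.∣b₁∣≤D ∷ proj₂ lw ∷ proj₂ lw′ ∷ [])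
      (λ where
        (here refl) D≤ h → cov₁ (∈-block G High? D≤ h)
        (there (here refl)) _ (inj₁ refl) → cov₁ (inj₁ refl)
        (there (here refl)) D≤ (inj₂ w∼y) → cov₂ w∼y (P.splitNbr D≤ w∼y)
        (there (there (here refl))) _ (inj₁ refl) → there (there (here (∈-nbrs⁺ G P₂? w∼w′ (proj₁ lw′))))
        (there (there (here refl))) D≤ (inj₂ w′∼y) → cov₃ w′∼y (P′.splitNbr D≤ w′∼y))
      (λ where
        (here refl) → w ∷ w′ ∷ [] , inj₂ (≤-refl , P.noLowNbr₁) , λ where
          (here refl) v∼v → contradiction v∼v (~-irrefl G)
          (there y∈) _ → y∈
        (there (here refl)) → v ∷ w′ ∷ [] , inj₂ (≤-refl , P.noLowNbr₂) , λ where
          (here refl) _ → here refl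
          (there (here refl)) w∼w → contradiction w∼w (~-irrefl G)
          (there (there y∈)) _ → there y∈
        (there (there (here refl))) → v ∷ w ∷ [] , inj₂ (≤-refl , P′.noLowNbr₂) , λ where
          (here refl) _ → here refl
          (there (here refl)) _ → there (here refl)
          (there (there (here refl))) w∼w → contradiction w∼w (~-irrefl G))
      (inj₁ ≤-refl)
    where
    module P = Pair vw
    module P′ = Pair v′w′
    bs = P.b₁ ∷ P.b₂ ∷ P′.b₂ ∷ []
    cov₁ : ∀ {y} → y ≡ w ⊎ y ∈ P.b₁ → Any (y ∈_) ([ v′ ] ∷ bs)
    cov₁ (inj₁ refl) = there (there (there (here (∈-nbrs⁺ G P₂? (~-sym G w∼w′) (proj₁ lw)))))
    cov₁ (inj₂ y∈) = there (here y∈)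
    cov₂ : ∀ {y} → w ∼ y → y ≡ v ⊎ Rest G High? D y → Any (y ∈_) ([ v′ ] ∷ bs)
    cov₂ _ (inj₁ refl) = there (here (here refl))
    cov₂ w∼y (inj₂ py) = there (there (here (∈-nbrs⁺ G P₂? w∼y py)))
    cov₃ : ∀ {y} → w′ ∼ y → y ≡ v′ ⊎ Rest G High? D y → Any (y ∈_) ([ v′ ] ∷ bs)
    cov₃ _ (inj₁ refl) = here (here refl)
    cov₃ w′∼y (inj₂ py) = there (there (there (here (∈-nbrs⁺ G P₂? w′∼y py))))

  noTwoL₂Nbrs : ∀ {v w w′} → Pair v w → Pair v w′ → w ≢ w′ → False
  noTwoL₂Nbrs {v} {w} {w′} vw v′w′ w≢w′ =
    blocksNoCheap (v ∷ w ∷ w′ ∷ []) [ v ] bs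
      ((P.v≢w ∷ P′.v≢w ∷ []) ∷ (w≢w′ ∷ []) ∷ [] ∷ [])
      (λ { (here refl) → proj₁ P.low₁ ; (there (here refl)) → L₂⇒High lw ; (there (there (here refl))) → L₂⇒High lw′ })
      (s≤s z≤n) refl (proj₂ P.low₁ ∷ proj₂ lw ∷ proj₂ lw′ ∷ [])
      (λ where
        (here refl) _ (inj₁ refl) → here (here refl)
        (here refl) D≤ (inj₂ v∼y) → there (here (∈-nbrs⁺ G High? v∼y D≤))
        (there (here refl)) D≤ (inj₁ refl) → there (here (∈-nbrs⁺ G High? P.edge′ D≤))
        (there (here refl)) D≤ (inj₂ w∼y) → Sum.[_,_]′ (λ { refl → here (here refl) })
          (λ py → there (there (here (∈-nbrs⁺ G P₂? w∼y py)))) (P.splitNbr D≤ w∼y)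
        (there (there (here refl))) D≤ (inj₁ refl) → there (here (∈-nbrs⁺ G High? P′.edge′ D≤))
        (there (there (here refl))) D≤ (inj₂ w′∼y) → Sum.[_,_]′ (λ { refl → here (here refl) })
          (λ py → there (there (there (here (∈-nbrs⁺ G P₂? w′∼y py))))) (P′.splitNbr D≤ w′∼y))
      (λ where
        (here refl) → w ∷ w′ ∷ [] , inj₂ (≤-refl , P.noLowNbr₁) , λ where
          (here refl) v∼v → contradiction v∼v (~-irrefl G)
          (there y∈) _ → y∈
        (there (here refl)) → [ v ] , inj₁ ≤-refl , λ where
          (here refl) _ → here refl
          (there (here refl)) w∼w → contradiction w∼w (~-irrefl G)
          (there (there (here refl))) w∼w′ → contradiction w∼w′ (L₂-independent lw lw′)
        (there (there (here refl))) → [ v ] , inj₁ ≤-refl , λ where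
          (here refl) _ → here refl
          (there (here refl)) w′∼w → contradiction w′∼w (L₂-independent lw′ lw)
          (there (there (here refl))) w∼w → contradiction w∼w (~-irrefl G))
      (inj₁ ≤-refl)
    where
    module P = Pair vw
    module P′ = Pair v′w′
    lw = P.low₂
    lw′ = P′.low₂
    bs = nbrs G High? v ∷ P.b₂ ∷ P′.b₂ ∷ []

  noTwoPairs : ∀ {x v w v′ w′} → Rest G High? D x → Pair v w → Pair v′ w′ → x ∼ w → x ∼ w′ → w ≢ w′ → False
  noTwoPairs {x} {v} {w} {v′} {w′} px vw v′w′ x∼w x∼w′ w≢w′ =
    blocksNoCheap (v ∷ w ∷ v′ ∷ w′ ∷ []) [ x ] bs
      ((P.v≢w ∷ v≢v′ ∷ L₁≢P₂ P.low₁ (proj₁ lw′) ∷ []) ∷ ((λ { refl → L₁≢P₂ P′.low₁ (proj₁ lw) refl }) ∷ w≢w′ ∷ [])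
        ∷ (P′.v≢w ∷ []) ∷ [] ∷ [])
      (λ where
        (here refl) → proj₁ P.low₁
        (there (here refl)) → L₂⇒High lw
        (there (there (here refl))) → proj₁ P′.low₁
        (there (there (there (here refl)))) → L₂⇒High lw′)
      (s≤s z≤n) refl (P.∣b₁∣≤D ∷ ∣block₂∣≤D lw x∼w ∷ P′.∣b₁∣≤D ∷ ∣block₂∣≤D lw′ x∼w′ ∷ [])
      (λ where
        (here refl) D≤ h → Sum.[_,_]′ (λ { refl → there (there (here (here refl))) })
          (λ y∈ → there (here y∈)) (∈-block G High? D≤ h)
        (there (here refl)) _ (inj₁ refl) → there (there (here (here refl)))
        (there (here refl)) D≤ (inj₂ w∼y) → Sum.[_,_]′ (λ { refl → there (here (here refl)) })
          (λ py → hub (∈-block G P₂? py (inj₂ w∼y)) (there (here refl))) (P.splitNbr D≤ w∼y)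
        (there (there (here refl))) D≤ h → Sum.[_,_]′ (λ { refl → there (there (there (there (here (here refl))))) })
          (λ y∈ → there (there (there (here y∈)))) (∈-block G High? D≤ h)
        (there (there (there (here refl)))) _ (inj₁ refl) → there (there (there (there (here (here refl)))))
        (there (there (there (here refl)))) D≤ (inj₂ w′∼y) → Sum.[_,_]′ (λ { refl → there (there (there (here (here refl)))) })
          (λ py → hub (∈-block G P₂? py (inj₂ w′∼y)) (there (there (there (here refl))))) (P′.splitNbr D≤ w′∼y))
      (λ where
        (here refl) → [ w ] , inj₁ ≤-refl , λ where
          (here refl) v∼v → contradiction v∼v (~-irrefl G)
          (there (here refl)) _ → here refl
          (there (there (here refl))) v∼v′ → contradiction v∼v′ (L₁-independent P.low₁ P′.low₁)
          (there (there (there (here refl)))) v∼w′ → ⊥-elim (w′≁v (~-sym G v∼w′))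
        (there (here refl)) → [ v ] , inj₁ ≤-refl , λ where
          (here refl) _ → here refl
          (there (here refl)) w∼w → contradiction w∼w (~-irrefl G)
          (there (there (here refl))) w∼v′ → ⊥-elim (w≁v′ w∼v′)
          (there (there (there (here refl)))) w∼w′ → contradiction w∼w′ (L₂-independent lw lw′)
        (there (there (here refl))) → [ w′ ] , inj₁ ≤-refl , λ where
          (here refl) v′∼v → contradiction v′∼v (L₁-independent P′.low₁ P.low₁)
          (there (here refl)) v′∼w → ⊥-elim (w≁v′ (~-sym G v′∼w))
          (there (there (here refl))) v∼v → contradiction v∼v (~-irrefl G)
          (there (there (there y∈))) _ → y∈
        (there (there (there (here refl)))) → [ v′ ] , inj₁ ≤-refl , λ where
          (here refl) w′∼v → ⊥-elim (w′≁v w′∼v)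
          (there (here refl)) w′∼w → contradiction w′∼w (L₂-independent lw′ lw)
          (there (there (here refl))) _ → here refl
          (there (there (there (here refl)))) w∼w → contradiction w∼w (~-irrefl G))
      (inj₁ (m≤m+n 6 2))
    where
    module P = Pair vw
    module P′ = Pair v′w′
    lw = P.low₂
    lw′ = P′.low₂
    v≢v′ : v ≢ v′
    v≢v′ refl = noTwoL₂Nbrs vw v′w′ w≢w′
    bs = P.b₁ ∷ block G P₂? w x ∷ P′.b₁ ∷ block G P₂? w′ x ∷ []
    ∣block₂∣≤D : ∀ {u} → L₂ u → x ∼ u → length (block G P₂? u x) ≤ D
    ∣block₂∣≤D lu x∼u = ≤-trans (length-block≤ G P₂? (~-sym G x∼u) px) (proj₂ lu)
    w≁v′ : ¬ w ∼ v′
    w≁v′ w∼v′ = v≢v′ (L₁Nbr-unique lw P.low₁ P′.low₁ P.edge w∼v′)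
    w′≁v : ¬ w′ ∼ v
    w′≁v w′∼v = v≢v′ (L₁Nbr-unique lw′ P.low₁ P′.low₁ w′∼v P′.edge)

  L₂Nbr-unique : ∀ {x w w′} → L₃ x → L₂ w → L₂ w′ → x ∼ w → x ∼ w′ → w ≡ w′
  L₂Nbr-unique {w = w} {w′} ((px , _) , _) lw lw′ x∼w x∼w′ = decidable-stable (w ≟ w′)
    (noTwoPairs px (proj₂ (pairOf lw)) (proj₂ (pairOf lw′)) x∼w x∼w′)

  module _ {x v w : Fin n} (lx : L₃ x) (vw : Pair v w) (x∼w : x ∼ w) where

    private
      module P = Pair vw
      px = proj₁ (proj₁ lx)
      w∼x = ~-sym G x∼w

    L₃-L₁Nbr : ∀ {v′} → L₁ v′ → x ∼ v′ → v ≡ v′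
    L₃-L₁Nbr {v′} lv′ x∼v′ = decidable-stable (v ≟ v′) λ v≢v′ →
      let
        w≁v′ : ¬ w ∼ v′
        w≁v′ w∼v′ = v≢v′ (L₁Nbr-unique P.low₂ P.low₁ lv′ P.edge w∼v′)
      in
      blocksNoCheap (v ∷ w ∷ v′ ∷ []) [ w ] (P.b₁ ∷ P.b₂ ∷ block G High? v′ x ∷ [])
        ((P.v≢w ∷ v≢v′ ∷ []) ∷ ((λ { refl → L₁≢P₂ lv′ (proj₁ P.low₂) refl }) ∷ []) ∷ [] ∷ [])
        (λ { (here refl) → proj₁ P.low₁ ; (there (here refl)) → L₂⇒High P.low₂ ; (there (there (here refl))) → proj₁ lv′ })
        (s≤s z≤n) refl (P.∣b₁∣≤D ∷ proj₂ P.low₂ ∷ length-block₁≤ lv′ (proj₁ px) x∼v′ ∷ [])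
        (λ where
          (here refl) → P.cover₁
          (there (here refl)) → P.cover₂
          (there (there (here refl))) D≤ h → Sum.[_,_]′
            (λ { refl → there (there (here (∈-nbrs⁺ G P₂? w∼x px))) })
            (λ y∈ → there (there (there (here y∈)))) (∈-block G High? D≤ h))
        (λ where
          (here refl) → [ w ] , inj₁ ≤-refl , λ where
            (here refl) v∼v → contradiction v∼v (~-irrefl G)
            (there (here refl)) _ → here refl
            (there (there (here refl))) v∼v′ → contradiction v∼v′ (L₁-independent P.low₁ lv′)
          (there (here refl)) → [ v ] , inj₁ ≤-refl , λ where
            (here refl) _ → here refl
            (there (here refl)) w∼w → contradiction w∼w (~-irrefl G)
            (there (there (here refl))) w∼v′ → ⊥-elim (w≁v′ w∼v′)
          (there (there (here refl))) → [] , inj₁ z≤n , λ where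
            (here refl) v′∼v → contradiction v′∼v (L₁-independent lv′ P.low₁)
            (there (here refl)) v′∼w → ⊥-elim (w≁v′ (~-sym G v′∼w))
            (there (there (here refl))) v∼v → contradiction v∼v (~-irrefl G))
        (inj₁ ≤-refl)

    L₃-absurd : False
    L₃-absurd =
      blocksNoCheap (v ∷ w ∷ x ∷ []) [ w ] bs
        ((P.v≢w ∷ L₁≢P₂ P.low₁ px ∷ []) ∷ (∼⇒≢ w∼x ∷ []) ∷ [] ∷ [])
        (λ { (here refl) → proj₁ P.low₁ ; (there (here refl)) → L₂⇒High P.low₂ ; (there (there (here refl))) → proj₁ px })
        (s≤s z≤n) refl (P.∣b₁∣≤D ∷ proj₂ P.low₂ ∷ proj₂ lx ∷ [])
        (λ where
          (here refl) → P.cover₁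
          (there (here refl)) → P.cover₂
          (there (there (here refl))) _ (inj₁ refl) → there (there (here (∈-nbrs⁺ G P₂? w∼x px)))
          (there (there (here refl))) D≤ (inj₂ x∼y) → coverNbr x∼y (low⊎rest G High? D D≤))
        (λ where
          (here refl) → w ∷ x ∷ [] , inj₂ (≤-refl , P.noLowNbr₁) , λ where
            (here refl) v∼v → contradiction v∼v (~-irrefl G)
            (there y∈) _ → y∈
          (there (here refl)) → v ∷ x ∷ [] , inj₂ (≤-refl , P.noLowNbr₂) , λ where
            (here refl) _ → here refl
            (there (here refl)) w∼w → contradiction w∼w (~-irrefl G)
            (there (there y∈)) _ → there y∈
          (there (there (here refl))) → v ∷ w ∷ [] , inj₂ (≤-refl , P.noLowNbr (proj₁ px) (inj₂ (inj₂ w∼x))) , λ where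
            (here refl) _ → here refl
            (there (here refl)) _ → there (here refl)
            (there (there (here refl))) x∼x → contradiction x∼x (~-irrefl G))
        (inj₁ ≤-refl)
      where
      bs = P.b₁ ∷ P.b₂ ∷ nbrs G P₃? x ∷ []
      coverNbr₂ : ∀ {y} → x ∼ y → L₂ y ⊎ Rest G P₂? D y → Any (y ∈_) ([ w ] ∷ bs)
      coverNbr₂ x∼y (inj₁ ly) = here (here (L₂Nbr-unique lx ly P.low₂ x∼y x∼w))
      coverNbr₂ x∼y (inj₂ py) = there (there (there (here (∈-nbrs⁺ G P₃? x∼y py))))
      coverNbr : ∀ {y} → x ∼ y → L₁ y ⊎ Rest G High? D y → Any (y ∈_) ([ w ] ∷ bs)
      coverNbr x∼y (inj₁ ly) = there (here (here (sym (L₃-L₁Nbr ly x∼y))))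
      coverNbr x∼y (inj₂ py) = coverNbr₂ x∼y (low⊎rest G P₂? D py)

  L₃-empty : ∀ {x} → ¬ L₃ x
  L₃-empty lx = let w , lw , x∼w = lowRest⇒lowNbr G P₂? D lx in
    L₃-absurd lx (proj₂ (pairOf lw)) x∼w

  module _ (isζ : ∀ v → IsZeta G v (ζ v)) (0<D : 0 < D) where

    P₂-level : ∀ {y} → Rest G High? D y → ζ y ≤ D → L₂ y
    P₂-level py ζy≤D with low⊎rest G P₂? D py
    ... | inj₁ ly = ly
    ... | inj₂ p₃y = contradiction (proj₂ (peel G P₃? isζ p₃y ζy≤D)) L₃-empty

    -- Since L₂ is independent, the neighbours of w in P₂ have ζ > D.
    L₂-empty : ∀ {w} → ¬ L₂ w
    L₂-empty {w} lw with pairOf lw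
    ... | v , vw =
      hangingNoCheap (v ∷ w ∷ []) C ((P.v≢w ∷ []) ∷ [] ∷ [])
        (λ { (here refl) → proj₁ P.low₁ ; (there (here refl)) → L₂⇒High lw })
        (λ { (here refl) D≤ h → inC (P.cover₁ D≤ h) ; (there (here refl)) D≤ h → inC (P.cover₂ D≤ h) })
        (λ { (here refl) → sparse⇒deg≤2 (proj₁ P.low₁) ([ w ] , inj₁ ≤-refl , λ where
               (here refl) v∼v → contradiction v∼v (~-irrefl G)
               (there y∈) _ → y∈)
           ; (there (here refl)) → sparse⇒deg≤2 (L₂⇒High lw) ([ v ] , inj₁ ≤-refl , λ where
               (here refl) _ → here refl
               (there (here refl)) w∼w → contradiction w∼w (~-irrefl G)) })
        (s≤s z≤n) (begin
        sum (map c C)                                        ≡⟨ cong (λ m → c w + m) (sum-map-++ c P.b₁ P.b₂) ⟩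
        c w + (sum (map c P.b₁) + sum (map c P.b₂))
          ≤⟨ +-mono-≤ (cost≤84r (L₂⇒High lw)) (+-mono-≤ (sum-map≤ c (84 * r) P.b₁ b₁-cost) (sum-map≤ c (84 * p) P.b₂ b₂-cost)) ⟩
        84 * r + (length P.b₁ * (84 * r) + length P.b₂ * (84 * p))
          ≤⟨ +-monoʳ-≤ (84 * r) (+-mono-≤ (*-monoˡ-≤ (84 * r) P.∣b₁∣≤D) (*-monoˡ-≤ (84 * p) (proj₂ lw))) ⟩
        84 * r + (D * (84 * r) + D * (84 * p))               ≤⟨ pair-budget 0<D ⟩
        K * 2                                                ≤⟨ m≤m+n (K * 2) _ ⟩
        K * 2 + length (hanging C) * (42 * r)                ∎)
      where
      open ≤-Reasoning
      module P = Pair vw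
      C = w ∷ P.b₁ ++ P.b₂
      inC : ∀ {y} → Any (y ∈_) ([ w ] ∷ P.b₁ ∷ P.b₂ ∷ []) → y ∈ C
      inC (here (here refl)) = here refl
      inC (there (here y∈)) = there (∈-++⁺ˡ y∈)
      inC (there (there (here y∈))) = there (∈-++⁺ʳ P.b₁ y∈)
      b₁-cost : ∀ {y} → y ∈ P.b₁ → c y ≤ 84 * r
      b₁-cost (here refl) = cost≤84r (proj₁ P.low₁)
      b₁-cost (there y∈) = cost≤84r (proj₂ (∈-nbrs⁻ G High? (proj₁ (∈-filter⁻ _ {xs = nbrs G High? v} y∈))))
      b₂-cost : ∀ {y} → y ∈ P.b₂ → c y ≤ 84 * p
      b₂-cost y∈ = let w∼y , py = ∈-nbrs⁻ G P₂? y∈ in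
        cost-high (≰⇒> λ ζy≤D → L₂-independent lw (P₂-level py ζy≤D) w∼y)

    level⇒L₁ : ∀ {y} → D ≤ ζ y → ζ y ≤ D → L₁ y
    level⇒L₁ D≤ζy ζy≤D with low⊎rest G High? D D≤ζy
    ... | inj₁ ly = ly
    ... | inj₂ py = contradiction (proj₂ (peel G P₂? isζ py ζy≤D)) L₂-empty

    singleNoCheap : ∀ {v} → D ≤ ζ v → ζ v ≤ D → 3 ≤ D ⊎ (∃ λ a → ζ a < D × a ∼ v) → False
    singleNoCheap {v} D≤ζv ζv≤D h =
      hangingNoCheap [ v ] C ([] ∷ [])
        (λ { (here refl) → D≤ζv })
        (λ { (here refl) _ (inj₁ refl) → here refl ; (here refl) D≤ (inj₂ v∼y) → there (∈-nbrs⁺ G High? v∼y D≤) })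
        (λ { (here refl) → sparse⇒deg≤2 D≤ζv (L₁-sparse (lv ∷ []) (here refl)) })
        (s≤s z≤n) (begin
        c v + sum (map c (nbrs G High? v))      ≤⟨ +-mono-≤ (cost≤84r D≤ζv) (sum-map≤ c (84 * p) _ nbr-cost) ⟩
        84 * r + length (nbrs G High? v) * (84 * p)   ≤⟨ +-monoʳ-≤ (84 * r) (*-monoˡ-≤ (84 * p) (proj₂ lv)) ⟩
        84 * r + D * (84 * p)                   ≤⟨ Sum.[_,_]′ (λ 3≤D → ≤-trans (single-budget 3≤D) (m≤m+n _ _))
          (λ (a , a<D , a∼v) → ≤-trans (single-budget-hanging 0<D) (+-monoʳ-≤ (K * 1) (*-monoˡ-≤ (42 * r)
            (unique⊆⇒length≤ ([] ∷ []) λ { (here refl) → ∈-hanging⁺ a<D (here refl) a∼v })))) h ⟩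
        K * 1 + length (hanging C) * (42 * r)   ∎)
      where
      open ≤-Reasoning
      C = v ∷ nbrs G High? v
      lv = level⇒L₁ D≤ζv ζv≤D
      nbr-cost : ∀ {y} → y ∈ nbrs G High? v → c y ≤ 84 * p
      nbr-cost y∈ = let v∼y , D≤ζy = ∈-nbrs⁻ G High? y∈ in
        cost-high (≰⇒> λ ζy≤D → L₁-independent lv (level⇒L₁ D≤ζy ζy≤D) v∼y)

    level-noLowNbr : ∀ {v a} → D ≤ ζ v → ζ v ≤ D → v ∼ a → D ≤ ζ a
    level-noLowNbr D≤ζv ζv≤D v∼a = ≮⇒≥ λ a<D →
      singleNoCheap D≤ζv ζv≤D (inj₂ (_ , a<D , ~-sym G v∼a))

    peeled-suc : Peeled G ζ (suc D)
    peeled-suc = record { deg≤ζ = deg ; ζ≤2 = small ; nbrHigh = indep }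
      where
      deg : ∀ {a} → ζ a < suc D → length (nbrs G U? a) ≤ ζ a
      deg {a} (s≤s ζa≤D) with D ≤? ζ a
      ... | no D≰ζa = deg≤ζ (≰⇒> D≰ζa)
      ... | yes D≤ζa = ≤-trans (nbrs-mono G U? High? λ a∼y _ → level-noLowNbr D≤ζa ζa≤D a∼y)
        (≤-trans (proj₂ (level⇒L₁ D≤ζa ζa≤D)) D≤ζa)
      small : ∀ {a} → ζ a < suc D → ζ a ≤ 2
      small {a} (s≤s ζa≤D) with D ≤? ζ a
      ... | no D≰ζa = ζ≤2 (≰⇒> D≰ζa)
      ... | yes D≤ζa = ≤-trans ζa≤D (≮⇒≥ λ 3≤D → singleNoCheap D≤ζa ζa≤D (inj₁ 3≤D))
      indep : ∀ {a b} → ζ a < suc D → a ∼ b → D < ζ b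
      indep {a} {b} (s≤s ζa≤D) a∼b with D ≤? ζ a
      ... | no D≰ζa = ≰⇒> λ ζb≤D →
        singleNoCheap (nbrHigh (≰⇒> D≰ζa) a∼b) ζb≤D (inj₂ (a , ≰⇒> D≰ζa , a∼b))
      ... | yes D≤ζa = ≰⇒> λ ζb≤D → L₁-independent (level⇒L₁ D≤ζa ζa≤D)
        (level⇒L₁ (level-noLowNbr D≤ζa ζa≤D a∼b) ζb≤D) a∼b

IsCheap? : ∀ {n} (G : Graph n) ζ k S → Dec (IsCheap G ζ k S)
IsCheap? G ζ k S =
  all? (λ v → (v ∈ₛ? S) →-dec ¬? (nonempty? (adj G v)))
  ⊎-dec (all? (λ v → (v ∈ₛ? S) →-dec nonempty? (adj G v))
    ×-dec (_ ℚ.≤? _)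
    ×-dec all? (λ v → (v ∈ₛ? S) →-dec (∣ adj G v ∩ S ∣ ≤? k)))

theorem6 : (n : ℕ) (G : Graph (suc n)) (ζ : Fin (suc n) → ℕ)
    → (∀ v → IsZeta G v (ζ v))
    → Σ (Subset (suc n)) λ S → Nonempty S × IsCheap G ζ 2 S
theorem6 n G ζ isζ = decidable-stable (anySubset? λ S → nonempty? S ×-dec IsCheap? G ζ 2 S) absurd
  where
  module _ (∄cheap : ¬ Σ (Subset (suc n)) λ S → Nonempty S × IsCheap G ζ 2 S) where

    noCheap : ∀ S → Nonempty S → ¬ IsCheap G ζ 2 S
    noCheap S S≠∅ cheap = ∄cheap (S , S≠∅ , cheap)

    ζ>0 : ∀ v → 0 < ζ v
    ζ>0 v = ≰⇒> λ ζv≤0 →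
      let x , _ , deg≤0 = peel G U? isζ _ ζv≤0
          _ , x∼y = noIsolated G ζ noCheap x
      in <⇒≱ (unique⊆⇒length≤ ([] ∷ []) λ { (here refl) → ∈-nbrs⁺ G U? x∼y _ }) deg≤0

    peeled : ∀ D → Peeled G ζ (suc D)
    peeled zero = record
      { deg≤ζ   = λ ζ<1 → contradiction ζ<1 (≤⇒≯ (ζ>0 _))
      ; ζ≤2     = λ ζ<1 → contradiction ζ<1 (≤⇒≯ (ζ>0 _))
      ; nbrHigh = λ _ _ → ζ>0 _
      }
    peeled (suc D) = Level.peeled-suc G ζ noCheap (suc D) (peeled D) isζ (s≤s z≤n)

    absurd : False
    absurd = let w , v∼w = noIsolated G ζ noCheap fzero in
      <⇒≱ (Peeled.nbrHigh (peeled (ζ fzero + ζ w)) (s≤s (m≤m+n (ζ fzero) (ζ w))) v∼w)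
          (m≤n+m (ζ w) (ζ fzero))
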